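{- With respect to DTMCs, HyperPCTL$^*$ is strictly more expressive than PCTL$^*$: every PCTL$^*$ state formula is expressible by a HyperPCTL$^*$ formula with the same satisfaction on every DTMC, and there exists a HyperPCTL$^*$ formula (all of whose path variables are quantified by probability operators) that is not expressible by any PCTL$^*$ state formula.
   Context: A DTMC is $\mathcal{M}=(S,s_{\mathrm{init}},P,\mathsf{AP},L)$ with finite state set $S$, initial state $s_{\mathrm{init}}$, transition probability function $P:S\times S\to[0,1]$ with rows summing to $1$, atomic propositions $\mathsf{AP}$ and labeling $L:S\to2^{\mathsf{AP}}$. Paths are infinite sequences of states with nonzero transition probabilities, with the usual probability measure; $\sigma^{(i)}$ is the $i$-suffix. PCTL$^*$: state formulas $\Phi::=a\mid\neg\Phi\mid\Phi\wedge\Phi\mid\mathbb{P}^J(\varphi)$, path formulas $\varphi::=\Phi\mid\neg\varphi\mid\varphi\wedge\varphi\mid\mathrm{X}\varphi\mid\varphi\,\mathrm{U}^{\le k}\varphi$ ($J\subseteq[0,1]$ interval with rational bounds, $k\in\mathbb{N}\cup\{\infty\}$), with standard semantics ($\mathbb{P}^J(\varphi)$ holds at $s$ iff the probability of a random path from $s$ satisfying $\varphi$ lies in $J$); $\mathcal{M}\models\Phi$ means $\Phi$ holds at $s_{\mathrm{init}}$. HyperPCTL$^*$: formulas $\varphi::= a^\pi\mid\varphi^\pi\mid\neg\varphi\mid\varphi\wedge\varphi\mid\mathrm{X}\varphi\mid\varphi\,\mathrm{U}^{\le k}\varphi\mid\rho\bowtie\rho$, $\rho::=f(\rho,\dots,\rho)\mid\mathbb{P}^{\underline\pi}(\varphi)\mid\mathbb{P}^{\underline\pi}(\rho)$,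 with $\pi$ path variables, $\underline\pi$ tuples of fresh path variables, $\bowtie\in\{<,>,=,\le,\ge\}$, $f$ elementary functions (constants allowed). Semantics w.r.t. a path assignment $V$ (mapping path variables to paths, by default starting at $s_{\mathrm{init}}$): $a^\pi$ holds iff $a\in L(V(\pi)(0))$; $\varphi^\pi$ holds iff $\varphi$ holds with all its free path variables assigned $V(\pi)$; temporal operators shift all assigned paths simultaneously; $\rho_1\bowtie\rho_2$ compares values; $[\![\mathbb{P}^{(\pi_1,\dots,\pi_n)}(\varphi)]\!]_V$ is the probability that, for independent random paths $\sigma_i$ from $V(\pi_i)(0)$, $\varphi$ holds under $V[\pi_i\mapsto\sigma_i]$; $f$ is applied to the values of its arguments. For a formula whose path variables are all quantified, $\mathcal{M}\models\varphi$ means $(\mathcal{M},V)\models\varphi$ for (any) $V$. A formula of one logic is expressible in the other if there is a formula of the other logic with the same truth value on every DTMC. -}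

module Defs where

open import Level using (0ℓ) renaming (suc to lsuc)
open import Algebra.Bundles using (CommutativeRing)
open import Axiom.ExcludedMiddle using (ExcludedMiddle)
open import Data.Bool.Base using (Bool; T; if_then_else_)
open import Data.Fin.Base using (Fin; toℕ) renaming (zero to fzero)
open import Data.Integer.Base using (ℤ; -[1+_]) renaming (+_ to pos)
open import Data.List.Base using (List; []; _∷_)
open import Data.Maybe.Base using (Maybe; just; nothing)
open import Data.Nat.Base as ℕ using (ℕ; zero; suc; NonZero; _!)
open import Data.Product.Base using (∃; _×_; _,_; proj₁)
open import Data.Rational.Base as ℚ using (ℚ; 0ℚ; 1ℚ)
open import Data.Unit.Base using (⊤)
open import Data.Empty using (⊥)
open import Data.Vec.Functional using (Vector; _++_)
open import Function.Base using (_∘_)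
open import Relation.Binary.Core using (Rel)
open import Relation.Binary.Structures using (IsTotalOrder)
open import Relation.Binary.PropositionalEquality.Core using (_≡_)
open import Relation.Nullary.Decidable.Core using (yes; no)
open import Relation.Nullary.Negation.Core using (¬_)
open import Relation.Nullary.Construct.Add.Supremum using (_⁺; [_])
open import Relation.Binary.Construct.Add.Supremum.NonStrict ℕ._≤_ using (_≤⁺_)
open import Relation.Unary using (Pred; _∈_)
import Algebra.Properties.CommutativeMonoid.Sum as Sum
import Algebra.Properties.Semiring.Exp as Exp
import Algebra.Properties.Semiring.Mult as Mult
import Relation.Binary.Construct.NonStrictToStrict as ToStrict

-- The real numbers are not in the library.  They are used through the axioms
-- of a complete ordered field, which classically determine them up to unique
-- isomorphism.
record CompleteOrderedField : Set (lsuc 0ℓ) where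
  infix 4 _≤_
  field
    commutativeRing : CommutativeRing 0ℓ 0ℓ

  open CommutativeRing commutativeRing public

  field
    _≤_          : Rel Carrier 0ℓ
    isTotalOrder : IsTotalOrder _≈_ _≤_
    0≉1          : ¬ 0# ≈ 1#
    inverse      : ∀ x → ¬ x ≈ 0# → ∃ λ y → x * y ≈ 1#
    +-monoˡ-≤    : ∀ z {x y} → x ≤ y → x + z ≤ y + z
    *-nonNeg     : ∀ {x y} → 0# ≤ x → 0# ≤ y → 0# ≤ x * y

  IsUpperBound : Pred Carrier 0ℓ → Carrier → Set
  IsUpperBound A u = ∀ x → x ∈ A → x ≤ u

  IsSupremum : Pred Carrier 0ℓ → Carrier → Set
  IsSupremum A s = IsUpperBound A s × (∀ u → IsUpperBound A u → s ≤ u)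

  field
    complete : ∀ A → ∃ (_∈ A) → ∃ (IsUpperBound A) → ∃ (IsSupremum A)

module Reals (em : ExcludedMiddle 0ℓ) (R : CompleteOrderedField) where

  open CompleteOrderedField R public
    using (_≈_; _≤_; _+_; _*_; _-_; -_; 0#; 1#) renaming (Carrier to ℝ)
  open CompleteOrderedField R
    using (IsSupremum; inverse; semiring; +-commutativeMonoid; *-commutativeMonoid)
  open ToStrict _≈_ _≤_ public using (_<_)
  open Sum +-commutativeMonoid public using (sum)
  open Sum *-commutativeMonoid public using () renaming (sum to product)
  open Exp semiring public using (_^_)
  open Mult semiring using () renaming (_×_ to _·_)

  -- sup, inf, recip and lim are total: they return 0 where there is no
  -- supremum, infimum or inverse.
  sup : Pred ℝ 0ℓ → ℝ
  sup A with em {∃ (IsSupremum A)}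
  ... | yes (s , _) = s
  ... | no  _       = 0#

  inf : Pred ℝ 0ℓ → ℝ
  inf A = - sup (λ x → - x ∈ A)

  recip : ℝ → ℝ
  recip x with em {x ≈ 0#}
  ... | yes _   = 0#
  ... | no  x≉0 = proj₁ (inverse x x≉0)

  -- The limit inferior, hence the limit of every convergent sequence.
  lim : (ℕ → ℝ) → ℝ
  lim a = sup λ x → ∃ λ N → ∀ n → N ℕ.≤ n → x ≤ a n

  ∑<_ : ℕ → (ℕ → ℝ) → ℝ
  (∑< n) a = sum {n} (a ∘ toℕ)

  series : (ℕ → ℝ) → ℝ
  series a = lim λ n → (∑< n) a

  fromℕ : ℕ → ℝ
  fromℕ n = n · 1#

  fromℤ : ℤ → ℝ
  fromℤ (pos n)  = fromℕ n
  fromℤ -[1+ n ] = - fromℕ (suc n)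

  fromℚ : ℚ → ℝ
  fromℚ q = fromℤ (ℚ.↥ q) * recip (fromℕ (ℚ.↧ₙ q))

  exp sin arcsin log : ℝ → ℝ
  exp    x = series λ i → x ^ i * recip (fromℕ (i !))
  sin    x = series λ i → (- 1#) ^ i * x ^ suc (2 ℕ.* i) * recip (fromℕ (suc (2 ℕ.* i) !))
  -- (2i)! / (4ⁱ (i!)² (2i+1)) · x²ⁱ⁺¹, convergent on [-1,1].
  arcsin x = series λ i →
    fromℕ ((2 ℕ.* i) !) * recip (fromℕ (4 ℕ.^ i ℕ.* (i !) ℕ.^ 2 ℕ.* suc (2 ℕ.* i)))
      * x ^ suc (2 ℕ.* i)
  log    y = sup λ x → exp x ≤ y

  root : ℕ → ℝ → ℝ
  root k x = sup λ y → y ^ k ≤ x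

  -- Elementary functions of n real arguments; cos, tan, arccos, arctan, the
  -- hyperbolic functions and general powers are compositions of these.
  -- Outside the natural domain of 1/x, roots, log and arcsin the conventions
  -- of sup and recip apply.
  data Elementary (n : ℕ) : Set where
    const       : ℝ → Elementary n
    arg         : Fin n → Elementary n
    plus times  : Elementary n → Elementary n → Elementary n
    neg inv     : Elementary n → Elementary n
    rootₑ       : (k : ℕ) .{{_ : NonZero k}} → Elementary n → Elementary n
    expₑ logₑ   : Elementary n → Elementary n
    sinₑ asinₑ  : Elementary n → Elementary n

  ⟦_⟧ₑ : ∀ {n} → Elementary n → Vector ℝ n → ℝ
  ⟦ const c   ⟧ₑ x = c
  ⟦ arg i     ⟧ₑ x = x i
  ⟦ plus f g  ⟧ₑ x = ⟦ f ⟧ₑ x + ⟦ g ⟧ₑ x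
  ⟦ times f g ⟧ₑ x = ⟦ f ⟧ₑ x * ⟦ g ⟧ₑ x
  ⟦ neg f     ⟧ₑ x = - ⟦ f ⟧ₑ x
  ⟦ inv f     ⟧ₑ x = recip (⟦ f ⟧ₑ x)
  ⟦ rootₑ k f ⟧ₑ x = root k (⟦ f ⟧ₑ x)
  ⟦ expₑ f    ⟧ₑ x = exp (⟦ f ⟧ₑ x)
  ⟦ logₑ f    ⟧ₑ x = log (⟦ f ⟧ₑ x)
  ⟦ sinₑ f    ⟧ₑ x = sin (⟦ f ⟧ₑ x)
  ⟦ asinₑ f   ⟧ₑ x = arcsin (⟦ f ⟧ₑ x)

-- An interval J ⊆ [0,1] with rational end points, each included or excluded.
record Interval : Set where
  field
    lower upper             : ℚ
    lowerClosed upperClosed : Bool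
    0≤lower                 : 0ℚ ℚ.≤ lower
    lower≤upper             : lower ℚ.≤ upper
    upper≤1                 : upper ℚ.≤ 1ℚ

data Comparison : Set where
  lt gt eq le ge : Comparison

module Logics (em : ExcludedMiddle 0ℓ) (R : CompleteOrderedField) (AP : Set) where

  open Reals em R

  _∈ᴵ_ : ℝ → Interval → Set
  x ∈ᴵ J = (if lowerClosed then fromℚ lower ≤ x else fromℚ lower < x)
         × (if upperClosed then x ≤ fromℚ upper else x < fromℚ upper)
    where open Interval J

  compare : Comparison → ℝ → ℝ → Set
  compare lt x y = x < y
  compare gt x y = y < x
  compare eq x y = x ≈ y
  compare le x y = x ≤ y
  compare ge x y = y ≤ x

  record DTMC : Set where
    field
      size : ℕ

    State : Set
    State = Fin size

    field
      init    : State
      P       : State → State → ℝ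
      P≥0     : ∀ s t → 0# ≤ P s t
      P≤1     : ∀ s t → P s t ≤ 1#
      row-sum : ∀ s → sum (P s) ≈ 1#
      label   : State → AP → Bool

  module Paths (M : DTMC) where

    open DTMC M public

    record Path : Set where
      field
        state : ℕ → State
        step  : ∀ i → ¬ P (state i) (state (suc i)) ≈ 0#

      first : State
      first = state 0

    open Path public

    suffix : ℕ → Path → Path
    suffix zero    σ = σ
    suffix (suc i) σ = suffix i record { state = state σ ∘ suc ; step = step σ ∘ suc }

    -- Independent random paths σ₁,…,σₖ, with σᵢ starting at a given state sᵢ.
    -- A rectangle is a product of cylinder sets: component i consists of the
    -- paths which, after sᵢ, continue with the given finite word.  `nothing` is
    -- the empty set.
    Rectangle : ℕ → Set
    Rectangle k = Maybe (Fin k → List State)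

    Follows : Path → List State → Set
    Follows σ []      = ⊤
    Follows σ (t ∷ w) = first (suffix 1 σ) ≡ t × Follows (suffix 1 σ) w

    InRectangle : ∀ {k} → (Fin k → Path) → Rectangle k → Set
    InRectangle σ nothing  = ⊥
    InRectangle σ (just w) = ∀ i → Follows (σ i) (w i)

    wordMass : State → List State → ℝ
    wordMass s []      = 1#
    wordMass s (t ∷ w) = P s t * wordMass t w

    mass : ∀ {k} → (Fin k → State) → Rectangle k → ℝ
    mass s nothing  = 0#
    mass s (just w) = product λ i → wordMass (s i) (w i)

    -- The probability of a set of k-tuples of paths, by Carathéodory's
    -- construction: the infimum, over countable covers by rectangles, of the
    -- total mass.  (A series of nonnegative terms is at most r iff all its
    -- partial sums are.)
    IsCover : ∀ {k} → (Fin k → State) → Pred (Fin k → Path) 0ℓ → (ℕ → Rectangle k) → Set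
    IsCover s A C = ∀ σ → (∀ i → first (σ i) ≡ s i) → σ ∈ A → ∃ λ n → InRectangle σ (C n)

    Pr : ∀ {k} → (Fin k → State) → Pred (Fin k → Path) 0ℓ → ℝ
    Pr s A = inf λ r → ∃ λ C → IsCover s A C × (∀ n → (∑< n) (mass s ∘ C) ≤ r)

    -- Lebesgue integral of max(g,0): the supremum over m of the integrals
    --   2⁻ᵐ Σ_{j=1}^{m2ᵐ} Pr(g ≥ j2⁻ᵐ)
    -- of the simple functions min(⌊2ᵐ g⌋ 2⁻ᵐ, m).
    integral⁺ : ∀ {k} → (Fin k → State) → ((Fin k → Path) → ℝ) → ℝ
    integral⁺ s g = sup λ r → ∃ λ m → let δ = recip (fromℕ (2 ℕ.^ m)) in
      r ≈ δ * (∑< (m ℕ.* 2 ℕ.^ m)) (λ j → Pr s λ σ → fromℕ (suc j) * δ ≤ g σ)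

    expectation : ∀ {k} → (Fin k → State) → ((Fin k → Path) → ℝ) → ℝ
    expectation s g = integral⁺ s g - integral⁺ s (-_ ∘ g)

  -- PCTL*.  Step bounds range over ℕ ⁺ = ℕ ∪ {∞}.

  data StateFormula : Set
  data PathFormula  : Set

  data StateFormula where
    atom : AP → StateFormula
    not  : StateFormula → StateFormula
    and  : StateFormula → StateFormula → StateFormula
    ℙ    : Interval → PathFormula → StateFormula

  data PathFormula where
    now   : StateFormula → PathFormula
    not   : PathFormula → PathFormula
    and   : PathFormula → PathFormula → PathFormula
    next  : PathFormula → PathFormula
    until : ℕ ⁺ → PathFormula → PathFormula → PathFormula

  module PCTL* (M : DTMC) where

    open Paths M

    _⊨ˢ_ : State → StateFormula → Set
    _⊨ᵖ_ : Path  → PathFormula  → Set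

    s ⊨ˢ atom a  = T (label s a)
    s ⊨ˢ not Φ   = ¬ s ⊨ˢ Φ
    s ⊨ˢ and Φ Ψ = s ⊨ˢ Φ × s ⊨ˢ Ψ
    s ⊨ˢ ℙ J φ   = Pr {1} (λ _ → s) (λ σ → σ fzero ⊨ᵖ φ) ∈ᴵ J

    σ ⊨ᵖ now Φ       = first σ ⊨ˢ Φ
    σ ⊨ᵖ not φ       = ¬ σ ⊨ᵖ φ
    σ ⊨ᵖ and φ ψ     = σ ⊨ᵖ φ × σ ⊨ᵖ ψ
    σ ⊨ᵖ next φ      = suffix 1 σ ⊨ᵖ φ
    σ ⊨ᵖ until k φ ψ = ∃ λ i → [ i ] ≤⁺ k × suffix i σ ⊨ᵖ ψ
                     × (∀ j → j ℕ.< i → suffix j σ ⊨ᵖ φ)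

  _⊨ᴾ_ : DTMC → StateFormula → Set
  M ⊨ᴾ Φ = init ⊨ˢ Φ
    where open DTMC M using (init)
          open PCTL* M

  -- HyperPCTL*.  HyperFormula n has n path variables in scope, as de Bruijn
  -- indices.  A probability operator binds a nonempty tuple of m+1 variables;
  -- these are fresh by construction, and become the indices 0,…,m.
  -- In HyperFormula 0 every path variable is quantified.

  data HyperFormula (n : ℕ) : Set
  data ProbExpr     (n : ℕ) : Set

  data HyperFormula n where
    atom  : AP → Fin n → HyperFormula n
    _at_  : HyperFormula n → Fin n → HyperFormula n
    not   : HyperFormula n → HyperFormula n
    and   : HyperFormula n → HyperFormula n → HyperFormula n
    next  : HyperFormula n → HyperFormula n
    until : ℕ ⁺ → HyperFormula n → HyperFormula n → HyperFormula n
    comp  : Comparison → ProbExpr n → ProbExpr n → HyperFormula n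

  data ProbExpr n where
    app : ∀ {k} → Elementary k → (Fin k → ProbExpr n) → ProbExpr n
    ℙ   : ∀ m → HyperFormula (suc m ℕ.+ n) → ProbExpr n
    𝔼   : ∀ m → ProbExpr (suc m ℕ.+ n) → ProbExpr n    -- ℙ applied to an expression

  module HyperPCTL* (M : DTMC) where

    open Paths M

    -- `origin` is the value of V(π)(0) for every variable π not yet assigned:
    -- initially s_init, unchanged by shifting the assigned paths.  The operator
    -- φ^π sends all variables to V(π), those quantified inside φ included, so
    -- that their random paths start at V(π)(0).
    record Assignment (n : ℕ) : Set where
      field
        origin : State
        path   : Fin n → Path

    open Assignment

    default : Assignment 0
    default = record { origin = init ; path = λ () }

    shift : ∀ {n} → ℕ → Assignment n → Assignment n
    shift i V = record { origin = origin V ; path = suffix i ∘ path V }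

    assignAll : ∀ {n} → Path → Assignment n
    assignAll σ = record { origin = first σ ; path = λ _ → σ }

    extend : ∀ {m n} → (Fin m → Path) → Assignment n → Assignment (m ℕ.+ n)
    extend σ V = record { origin = origin V ; path = σ ++ path V }

    _⊨_ : ∀ {n} → Assignment n → HyperFormula n → Set
    ⟦_⟧ : ∀ {n} → ProbExpr n → Assignment n → ℝ

    V ⊨ atom a π    = T (label (first (path V π)) a)
    V ⊨ (φ at π)    = assignAll (path V π) ⊨ φ
    V ⊨ not φ       = ¬ V ⊨ φ
    V ⊨ and φ ψ     = V ⊨ φ × V ⊨ ψ
    V ⊨ next φ      = shift 1 V ⊨ φ
    V ⊨ until k φ ψ = ∃ λ i → [ i ] ≤⁺ k × shift i V ⊨ ψ
                    × (∀ j → j ℕ.< i → shift j V ⊨ φ)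
    V ⊨ comp c ρ ρ′ = compare c (⟦ ρ ⟧ V) (⟦ ρ′ ⟧ V)

    ⟦ app f ρs ⟧ V = ⟦ f ⟧ₑ λ i → ⟦ ρs i ⟧ V
    ⟦ ℙ m φ    ⟧ V = Pr {suc m} (λ _ → origin V) λ σ → extend σ V ⊨ φ
    ⟦ 𝔼 m ρ    ⟧ V = expectation {suc m} (λ _ → origin V) λ σ → ⟦ ρ ⟧ (extend σ V)

  _⊨ᴴ_ : DTMC → HyperFormula 0 → Set
  M ⊨ᴴ φ = default ⊨ φ
    where open HyperPCTL* M

{-# OPTIONS --safe #-}
module Submission where

-- A PCTL* formula is translated with the path under consideration as path
-- variable, each probability operator being evaluated from the current state of
-- that path by means of φ^π.
--
-- The formula ℙ(X a) = ℙ(X X a) is not expressible.  In a Markov chain that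
-- branches once, into three deterministic continuations of probabilities x, y
-- and 1 - x - y, every path formula has as probability the sum of some of these
-- numbers.  A PCTL* formula compares them with finitely many constants only, so
-- every interval contains a smaller one such that the formula has the same truth
-- value for all x and y in it, whether or not x = y.
--
-- The probabilities needed are of events that are determined by the second state
-- of the path.  That the outer measure is not smaller than expected is seen by
-- descent: if the rectangles of a cover have total mass below 1, then so have
-- their residuals at some successor, and following such successors yields a path
-- outside the cover.

open import Defs
open import Level using (0ℓ)
open import Axiom.ExcludedMiddle using (ExcludedMiddle)
open import Data.Product.Base using (∃; _×_; _,_; proj₁; proj₂)
open import Function.Bundles using (_⇔_; mk⇔; Equivalence)
open import Relation.Nullary.Negation.Core using (¬_; contradiction)
open import Data.Bool.Base using (Bool; true; false; T; if_then_else_) renaming (not to notᵇ)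
open import Data.Empty using (⊥-elim)
open import Data.Fin.Base using (Fin; zero; suc; toℕ; pred)
open import Data.Fin.Patterns using (0F; 1F; 2F; 3F)
open import Data.Fin.Properties using (_≟_)
open import Data.List.Base using (List; []; _∷_)
open import Data.Maybe.Base as Maybe using (Maybe; just; nothing)
open import Data.Nat.Base as ℕ using (ℕ; z≤n; s≤s)
import Data.Nat.Properties as ℕ
open import Data.Product.Function.NonDependent.Propositional using (_×-⇔_)
open import Function.Properties.Equivalence using () renaming (sym to ⇔-sym; trans to ⇔-trans)
open import Data.Sum.Base using (_⊎_; inj₁; inj₂)
open import Data.Unit.Base using (tt)
open import Function.Base using (_∘_; id)
open import Relation.Binary.Bundles using (TotalOrder)
open import Relation.Binary.Structures using (IsTotalOrder)
open import Relation.Binary.PropositionalEquality.Core as ≡ using (_≡_; _≢_)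
open import Relation.Nullary.Decidable.Core using (yes; no; does; ⌊_⌋; toWitness; fromWitness)
open import Relation.Unary using (Pred; _∈_)
import Algebra.Properties.Ring as RingProperties
import Algebra.Properties.Semiring.Sum as SemiringSum
import Relation.Binary.Construct.NonStrictToStrict as ToStrict
import Relation.Binary.Reasoning.PartialOrder as ≤-Reasoning

-- Arithmetic in an ordered field: inequalities, midpoints, finite sums.

module OrderedField (R : CompleteOrderedField) where

  open CompleteOrderedField R public hiding (zero)
  open RingProperties ring public
  open SemiringSum semiring public
  open ToStrict _≈_ _≤_ public using (_<_)

  totalOrder : TotalOrder 0ℓ 0ℓ 0ℓ
  totalOrder = record { isTotalOrder = isTotalOrder }

  open IsTotalOrder isTotalOrder public using (total; antisym) renaming
    (refl to ≤-refl; reflexive to ≤-reflexive; trans to ≤-trans)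
  open ≤-Reasoning (TotalOrder.poset totalOrder) public

  ≰⇒> : ∀ {x y} → ¬ x ≤ y → y < x
  ≰⇒> = ToStrict.≰⇒> _≈_ _≤_ sym ≤-reflexive total

  <⇒≱ : ∀ {x y} → x < y → ¬ y ≤ x
  <⇒≱ = ToStrict.<⇒≱ _≈_ _≤_ antisym

  ≤-respˡ : ∀ {x y z} → x ≈ y → x ≤ z → y ≤ z
  ≤-respˡ x≈y = ≤-trans (≤-reflexive (sym x≈y))

  ≤-respʳ : ∀ {x y z} → x ≈ y → z ≤ x → z ≤ y
  ≤-respʳ x≈y z≤x = ≤-trans z≤x (≤-reflexive x≈y)

  +-mono-≤ : ∀ {w x y z} → w ≤ x → y ≤ z → w + y ≤ x + z
  +-mono-≤ {w} {x} {y} {z} w≤x y≤z = begin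
    w + y  ≤⟨ +-monoˡ-≤ y w≤x ⟩
    x + y  ≈⟨ +-comm x y ⟩
    y + x  ≤⟨ +-monoˡ-≤ x y≤z ⟩
    z + x  ≈⟨ +-comm z x ⟩
    x + z  ∎

  x-y≤z⇒x≤z+y : ∀ {x y z} → x - y ≤ z → x ≤ z + y
  x-y≤z⇒x≤z+y {x} {y} = ≤-respˡ (//-rightDividesˡ y x) ∘ +-monoˡ-≤ y

  x≤y+z⇒x-z≤y : ∀ {x y z} → x ≤ y + z → x - z ≤ y
  x≤y+z⇒x-z≤y {x} {y} {z} = ≤-respʳ (//-rightDividesʳ z y) ∘ +-monoˡ-≤ (- z)

  x≤z-y⇒x+y≤z : ∀ {x y z} → x ≤ z - y → x + y ≤ z
  x≤z-y⇒x+y≤z {x} {y} {z} = ≤-respʳ (//-rightDividesˡ y z) ∘ +-monoˡ-≤ y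

  x+y≤z⇒x≤z-y : ∀ {x y z} → x + y ≤ z → x ≤ z - y
  x+y≤z⇒x≤z-y {x} {y} = ≤-respˡ (//-rightDividesʳ y x) ∘ +-monoˡ-≤ (- y)

  x-y≤z⇒x-z≤y : ∀ {x y z} → x - y ≤ z → x - z ≤ y
  x-y≤z⇒x-z≤y {x} {y} {z} = x≤y+z⇒x-z≤y ∘ ≤-respʳ (+-comm z y) ∘ x-y≤z⇒x≤z+y

  x≤z-y⇒y≤z-x : ∀ {x y z} → x ≤ z - y → y ≤ z - x
  x≤z-y⇒y≤z-x {x} {y} {z} = x+y≤z⇒x≤z-y ∘ ≤-respˡ (+-comm x y) ∘ x≤z-y⇒x+y≤z

  +-cancelˡ-≤ : ∀ x {y z} → x + y ≤ x + z → y ≤ z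
  +-cancelˡ-≤ x {y} {z} h = ≤-respʳ (//-rightDividesʳ x z)
    (x+y≤z⇒x≤z-y (≤-respˡ (+-comm x y) (≤-respʳ (+-comm x z) h)))

  +-mono-< : ∀ {a b c d} → a < b → c < d → a + c < b + d
  +-mono-< {a} {b} {c} {d} (a≤b , a≉b) (c≤d , c≉d) = +-mono-≤ a≤b c≤d , λ a+c≈b+d →
    c≉d (antisym c≤d (+-cancelˡ-≤ a (≤-respʳ (sym a+c≈b+d) (+-mono-≤ a≤b ≤-refl))))

  neg-antitone : ∀ {x y} → x ≤ y → - y ≤ - x
  neg-antitone {x} {y} x≤y = ≤-respˡ (+-identityˡ (- y)) (x-y≤z⇒x-z≤y
    (≤-respˡ (sym (trans (+-identityˡ (- - x)) (-‿involutive x))) x≤y))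

  *-monoˡ-≤ : ∀ {p x y} → 0# ≤ p → x ≤ y → p * x ≤ p * y
  *-monoˡ-≤ {p} {x} {y} 0≤p x≤y = ≤-respˡ (+-identityˡ (p * x))
    (x≤z-y⇒x+y≤z (≤-respʳ (x[y-z]≈xy-xz p y x)
      (*-nonNeg 0≤p (x+y≤z⇒x≤z-y (≤-respˡ (sym (+-identityˡ x)) x≤y)))))

  0≤1 : 0# ≤ 1#
  0≤1 with total 0# 1#
  ... | inj₁ 0≤1 = 0≤1
  ... | inj₂ 1≤0 = ≤-respʳ [-1]²≈1 (*-nonNeg 0≤-1 0≤-1)
    where
    0≤-1 : 0# ≤ - 1#
    0≤-1 = ≤-respˡ -0#≈0# (neg-antitone 1≤0)
    [-1]²≈1 : - 1# * - 1# ≈ 1#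
    [-1]²≈1 = trans (-1*x≈-x (- 1#)) (-‿involutive 1#)

  halving : ∃ λ h → 0# ≤ h × h + h ≈ 1#
  halving with inverse (1# + 1#) 2≉0
    where
    2≉0 : ¬ 1# + 1# ≈ 0#
    2≉0 2≈0 = 0≉1 (antisym 0≤1 (≤-respˡ (+-identityˡ 1#) (≤-respʳ 2≈0 (+-monoˡ-≤ 1# 0≤1))))
  ... | h , 2h≈1 = h , 0≤h , h+h≈1
    where
    h+h≈1 : h + h ≈ 1#
    h+h≈1 = begin-equality
      h + h            ≈⟨ +-cong (*-identityˡ h) (*-identityˡ h) ⟨
      1# * h + 1# * h  ≈⟨ distribʳ h 1# 1# ⟨
      (1# + 1#) * h    ≈⟨ 2h≈1 ⟩
      1#               ∎
    0≤h : 0# ≤ h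
    0≤h with total 0# h
    -- The field axioms say nothing about the sign of an inverse; `h ≤ 0` would give
    -- `1 = h + h ≤ 0`.
    ... | inj₁ 0≤h = 0≤h
    ... | inj₂ h≤0 = contradiction (antisym 0≤1 (≤-respˡ h+h≈1
                       (≤-respʳ (+-identityˡ 0#) (+-mono-≤ h≤0 h≤0)))) 0≉1

  ½ : Carrier
  ½ = proj₁ halving

  0≤½ : 0# ≤ ½
  0≤½ = proj₁ (proj₂ halving)

  ½+½≈1 : ½ + ½ ≈ 1#
  ½+½≈1 = proj₂ (proj₂ halving)

  x½+x½≈x : ∀ x → x * ½ + x * ½ ≈ x
  x½+x½≈x x = begin-equality
    x * ½ + x * ½  ≈⟨ distribˡ x ½ ½ ⟨
    x * (½ + ½)    ≈⟨ *-congˡ ½+½≈1 ⟩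
    x * 1#         ≈⟨ *-identityʳ x ⟩
    x              ∎

  *½-cancel : ∀ {x y} → x * ½ ≈ y * ½ → x ≈ y
  *½-cancel {x} {y} x≈y = trans (sym (x½+x½≈x x)) (trans (+-cong x≈y x≈y) (x½+x½≈x y))

  *½-mono-≤ : ∀ {x y} → x ≤ y → x * ½ ≤ y * ½
  *½-mono-≤ {x} {y} = ≤-respˡ (*-comm ½ x) ∘ ≤-respʳ (*-comm ½ y) ∘ *-monoˡ-≤ 0≤½

  dense : ∀ {x y} → x < y → ∃ λ m → x < m × m < y
  dense {x} {y} (x≤y , x≉y) = x * ½ + y * ½ , (x≤m , x≉m) , (m≤y , m≉y)
    where
    x≤m : x ≤ x * ½ + y * ½
    x≤m = ≤-respˡ (x½+x½≈x x) (+-mono-≤ ≤-refl (*½-mono-≤ x≤y))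
    m≤y : x * ½ + y * ½ ≤ y
    m≤y = ≤-respʳ (x½+x½≈x y) (+-mono-≤ (*½-mono-≤ x≤y) ≤-refl)
    x≉m : ¬ x ≈ x * ½ + y * ½
    x≉m x≈y = x≉y (*½-cancel (+-cancelˡ (x * ½) _ _ (trans (x½+x½≈x x) x≈y)))
    m≉y : ¬ x * ½ + y * ½ ≈ y
    m≉y x≈y = x≉y (*½-cancel (+-cancelʳ (y * ½) _ _ (trans x≈y (sym (x½+x½≈x y)))))

  sum-mono-≤ : ∀ {n} {a b : Fin n → Carrier} → (∀ i → a i ≤ b i) → sum a ≤ sum b
  sum-mono-≤ {ℕ.zero}  a≤b = ≤-refl
  sum-mono-≤ {ℕ.suc n} a≤b = +-mono-≤ (a≤b zero) (sum-mono-≤ (a≤b ∘ suc))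

  sum-nonNeg : ∀ {n} {a : Fin n → Carrier} → (∀ i → 0# ≤ a i) → 0# ≤ sum a
  sum-nonNeg {n} 0≤a = ≤-respˡ (sum-replicate-zero n) (sum-mono-≤ 0≤a)

  lookup≤sum : ∀ {n} {a : Fin n → Carrier} → (∀ i → 0# ≤ a i) → ∀ i → a i ≤ sum a
  lookup≤sum 0≤a zero    = ≤-respˡ (+-identityʳ _) (+-mono-≤ ≤-refl (sum-nonNeg (0≤a ∘ suc)))
  lookup≤sum 0≤a (suc i) = ≤-respˡ (+-identityˡ _) (+-mono-≤ (0≤a zero) (lookup≤sum (0≤a ∘ suc) i))

  sum-zero : ∀ {n} {a : Fin n → Carrier} → (∀ i → a i ≈ 0#) → sum a ≈ 0#
  sum-zero {n} a≈0 = trans (sum-cong-≋ a≈0) (sum-replicate-zero n)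

  sum-supported : ∀ {n} {a : Fin n → Carrier} i → (∀ j → j ≢ i → a j ≈ 0#) → sum a ≈ a i
  sum-supported zero a≈0 =
    trans (+-congˡ (sum-zero λ j → a≈0 (suc j) λ ())) (+-identityʳ _)
  sum-supported (suc i) a≈0 =
    trans (+-cong (a≈0 zero λ ()) (sum-supported i λ j j≢i → a≈0 (suc j) λ { ≡.refl → j≢i ≡.refl }))
          (+-identityˡ _)

  𝟙 : Bool → Carrier
  𝟙 b = if b then 1# else 0#

  0≤𝟙 : ∀ b → 0# ≤ 𝟙 b
  0≤𝟙 true  = 0≤1
  0≤𝟙 false = ≤-refl

  𝟙+𝟙not≈1 : ∀ b → 𝟙 b + 𝟙 (notᵇ b) ≈ 1#
  𝟙+𝟙not≈1 true  = +-identityʳ 1#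
  𝟙+𝟙not≈1 false = +-identityˡ 1#

-- Suprema, infima and partial sums of nonnegative sequences.

module RealProperties (em : ExcludedMiddle 0ℓ) (R : CompleteOrderedField) where

  open OrderedField R
  open Reals em R using (sup; inf; ∑<_)

  sup-unique : ∀ {A : Pred Carrier 0ℓ} {s} → IsSupremum A s → sup A ≈ s
  sup-unique {A} {s} (s-ub , s-least) with em {∃ (IsSupremum A)}
  ... | yes (t , t-ub , t-least) = antisym (t-least s s-ub) (s-least t t-ub)
  ... | no  none                 = contradiction (s , s-ub , s-least) none

  IsSupremum-resp : ∀ {A B : Pred Carrier 0ℓ} {s} → (∀ x → A x ⇔ B x) → IsSupremum A s → IsSupremum B s
  IsSupremum-resp A⇔B (ub , least) =
    (λ x → ub x ∘ Equivalence.from (A⇔B x)) ,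
    (λ u u-ub → least u λ x → u-ub x ∘ Equivalence.to (A⇔B x))

  -- `sup` is total with default 0, so the case in which neither set has a supremum has to be
  -- matched as well.
  sup-cong : ∀ {A B : Pred Carrier 0ℓ} → (∀ x → A x ⇔ B x) → sup A ≈ sup B
  sup-cong {A} {B} A⇔B with em {∃ (IsSupremum A)}
  ... | yes (s , s-sup) = sym (sup-unique (IsSupremum-resp A⇔B s-sup))
  ... | no none with em {∃ (IsSupremum B)}
  ...   | no  _           = refl
  ...   | yes (s , s-sup) = contradiction (s , IsSupremum-resp B⇔A s-sup) none
    where
    B⇔A : ∀ x → B x ⇔ A x
    B⇔A x = mk⇔ (Equivalence.from (A⇔B x)) (Equivalence.to (A⇔B x))

  -- The infimum is attained here. The form `- - v` is what membership of `- v` in the reflected set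
  -- unfolds to, since `A` is an arbitrary predicate and may fail to respect `≈`.
  inf-unique : ∀ {A : Pred Carrier 0ℓ} {v} → A (- - v) → (∀ x → A x → v ≤ x) → inf A ≈ v
  inf-unique {A} {v} v∈A v-lb = trans (-‿cong (sup-unique (ub , λ u u-ub → u-ub (- v) v∈A))) (-‿involutive v)
    where
    ub : IsUpperBound (λ x → - x ∈ A) (- v)
    ub x -x∈A = ≤-respˡ (-‿involutive x) (neg-antitone (v-lb (- x) -x∈A))

  ∑<-mono : ∀ {m n} {a : ℕ → Carrier} → (∀ i → 0# ≤ a i) → m ℕ.≤ n → (∑< m) a ≤ (∑< n) a
  ∑<-mono {n = n} 0≤a z≤n       = sum-nonNeg {n} (0≤a ∘ toℕ)
  ∑<-mono         0≤a (s≤s m≤n) = +-mono-≤ ≤-refl (∑<-mono (0≤a ∘ ℕ.suc) m≤n)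

  term≤∑< : ∀ {a : ℕ → Carrier} → (∀ i → 0# ≤ a i) → ∀ n → a n ≤ (∑< ℕ.suc n) a
  term≤∑< 0≤a ℕ.zero    = ≤-reflexive (sym (+-identityʳ _))
  term≤∑< 0≤a (ℕ.suc n) = ≤-respˡ (+-identityˡ _) (+-mono-≤ (0≤a 0) (term≤∑< (0≤a ∘ ℕ.suc) n))

-- Outer measure on single paths, and its value on events determined by the second state.

module Measure (em : ExcludedMiddle 0ℓ) (R : CompleteOrderedField) (AP : Set)
               (M : Logics.DTMC em R AP) where

  open OrderedField R
  open RealProperties em R
  open Reals em R using (∑<_)
  open Logics em R AP
  open Paths M

  massOf : State → Maybe (List State) → Carrier
  massOf s nothing  = 0#
  massOf s (just w) = wordMass s w

  wordMass-nonNeg : ∀ s w → 0# ≤ wordMass s w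
  wordMass-nonNeg s []      = 0≤1
  wordMass-nonNeg s (t ∷ w) = *-nonNeg (P≥0 s t) (wordMass-nonNeg t w)

  massOf-nonNeg : ∀ s c → 0# ≤ massOf s c
  massOf-nonNeg s nothing  = ≤-refl
  massOf-nonNeg s (just w) = wordMass-nonNeg s w

  mass≈massOf : ∀ s c → mass {1} (λ _ → s) c ≈ massOf s (Maybe.map (λ w → w 0F) c)
  mass≈massOf s nothing  = refl
  mass≈massOf s (just w) = *-identityʳ (wordMass s (w 0F))

  -- What a cylinder still demands once the first step has gone to `t`. The whole space, given by
  -- `[]`, remains the whole space.
  residual : State → Maybe (List State) → Maybe (List State)
  residual t nothing        = nothing
  residual t (just [])      = just []
  residual t (just (u ∷ w)) with t ≟ u
  ... | yes _ = just w
  ... | no  _ = nothing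

  residual-∷ : ∀ t w → residual t (just (t ∷ w)) ≡ just w
  residual-∷ t w with t ≟ t
  ... | yes _   = ≡.refl
  ... | no  t≢t = contradiction ≡.refl t≢t

  -- Total probability over the first step: for `[]` this is the row sum, and for `u ∷ w` only the
  -- successor `u` contributes.
  massOf-residual : ∀ s c → sum (λ t → P s t * massOf t (residual t c)) ≈ massOf s c
  massOf-residual s nothing        = sum-zero λ t → zeroʳ (P s t)
  massOf-residual s (just [])      = trans (sum-cong-≋ λ t → *-identityʳ (P s t)) (row-sum s)
  massOf-residual s (just (u ∷ w)) = trans (sum-supported u vanish)
    (reflexive (≡.cong (λ c → P s u * massOf u c) (residual-∷ u w)))
    where
    vanish : ∀ t → t ≢ u → P s t * massOf t (residual t (just (u ∷ w))) ≈ 0#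
    vanish t t≢u with t ≟ u
    ... | yes t≡u = contradiction t≡u t≢u
    ... | no  _   = zeroʳ (P s t)

  totalMass : State → (ℕ → Maybe (List State)) → ℕ → Carrier
  totalMass s c N = (∑< N) (massOf s ∘ c)

  totalMass-residual : ∀ s c N → sum (λ t → P s t * totalMass t (residual t ∘ c) N) ≈ totalMass s c N
  totalMass-residual s c N = begin-equality
    sum (λ t → P s t * totalMass t (residual t ∘ c) N)
      ≈⟨ sum-cong-≋ (λ t → *-distribˡ-sum {N} (P s t) _) ⟩
    sum (λ t → sum {N} (λ n → P s t * massOf t (residual t (c (toℕ n)))))
      ≈⟨ ∑-comm {n = N} (λ t n → P s t * massOf t (residual t (c (toℕ n)))) ⟩
    sum {N} (λ n → sum (λ t → P s t * massOf t (residual t (c (toℕ n)))))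
      ≈⟨ sum-cong-≋ {N} (λ n → massOf-residual s (c (toℕ n))) ⟩
    totalMass s c N ∎

  commonBound : ∀ {n} (Q : Fin n → ℕ → Set) → (∀ i {k l} → k ℕ.≤ l → Q i k → Q i l) →
                (∀ i → ∃ (Q i)) → ∃ λ N → ∀ i → Q i N
  commonBound {ℕ.zero}  Q mono q = 0 , λ ()
  commonBound {ℕ.suc n} Q mono q with q zero | commonBound (Q ∘ suc) (mono ∘ suc) (q ∘ suc)
  ... | k , Qk | l , Ql = k ℕ.⊔ l , λ
    { zero    → mono zero (ℕ.m≤m⊔n k l) Qk
    ; (suc i) → mono (suc i) (ℕ.m≤n⊔m k l) (Ql i) }

  -- Each successor may need a different number of terms. There are finitely many successors and
  -- partial sums increase, so a common `N` exists, and the bounds are averaged with weights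
  -- `P s t`. Where `P s t` vanishes both sides are 0.
  totalMass-average : ∀ s c (u : State → Carrier) →
    (∀ t → ¬ P s t ≈ 0# → ∃ λ N → u t ≤ totalMass t (residual t ∘ c) N) →
    ∃ λ N → sum (λ t → P s t * u t) ≤ totalMass s c N
  totalMass-average s c u bound with commonBound Q mono Q-holds
    where
    Q : State → ℕ → Set
    Q t N = P s t * u t ≤ P s t * totalMass t (residual t ∘ c) N
    mono : ∀ t {k l} → k ℕ.≤ l → Q t k → Q t l
    mono t k≤l Qk = ≤-trans Qk (*-monoˡ-≤ (P≥0 s t)
      (∑<-mono (λ n → massOf-nonNeg t (residual t (c n))) k≤l))
    Q-holds : ∀ t → ∃ (Q t)
    Q-holds t with em {P s t ≈ 0#}
    ... | yes P≈0 = 0 , ≤-reflexive (trans (*-congʳ P≈0) (trans (zeroˡ (u t)) (sym (zeroʳ (P s t)))))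
    ... | no  P≉0 with bound t P≉0
    ...   | N , u≤ = N , *-monoˡ-≤ (P≥0 s t) u≤
  ... | N , Q-N = N , ≤-respʳ (totalMass-residual s c N) (sum-mono-≤ Q-N)

  -- Only the partial sums are below 1; their limit may equal 1, so no margin has to survive the
  -- descent.
  Light : State → (ℕ → Maybe (List State)) → Set
  Light s c = ∀ N → totalMass s c N < 1#

  light? : ∀ s c → Light s c ⊎ (∃ λ N → 1# ≤ totalMass s c N)
  light? s c with em {∃ λ N → 1# ≤ totalMass s c N}
  ... | yes heavy = inj₂ heavy
  ... | no  light = inj₁ λ N → ≰⇒> λ 1≤ → light (N , 1≤)

  -- If the residuals at every possible successor reached mass 1 after finitely many terms, their
  -- average, which is the mass at `s`, would reach 1 as well.
  light-step : ∀ s c → Light s c → ∃ λ t → ¬ P s t ≈ 0# × Light t (residual t ∘ c)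
  light-step s c light with em {∃ λ t → ¬ P s t ≈ 0# × Light t (residual t ∘ c)}
  ... | yes step = step
  ... | no  none with totalMass-average s c (λ _ → 1#) heavy
    where
    heavy : ∀ t → ¬ P s t ≈ 0# → ∃ λ N → 1# ≤ totalMass t (residual t ∘ c) N
    heavy t P≉0 with light? t (residual t ∘ c)
    ... | inj₁ light′ = contradiction (t , P≉0 , light′) none
    ... | inj₂ heavy′ = heavy′
  ...   | N , ≤N = contradiction (≤-respˡ ∑P1≈1 ≤N) (<⇒≱ (light N))
    where
    ∑P1≈1 : sum (λ t → P s t * 1#) ≈ 1#
    ∑P1≈1 = trans (sum-cong-≋ λ t → *-identityʳ (P s t)) (row-sum s)

  record LightCover : Set where
    field
      origin    : State
      cover : ℕ → Maybe (List State)
      light : Light origin cover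

  open LightCover

  lightSuccessor : ∀ d → ∃ λ t → ¬ P (origin d) t ≈ 0# × Light t (residual t ∘ cover d)
  lightSuccessor d = light-step (origin d) (cover d) (light d)

  descend : LightCover → LightCover
  descend d = let t , _ , light′ = lightSuccessor d in
    record { origin = t ; cover = residual t ∘ cover d ; light = light′ }

  descentState : LightCover → ℕ → State
  descentState d ℕ.zero    = origin d
  descentState d (ℕ.suc i) = descentState (descend d) i

  descentStep : ∀ d i → ¬ P (descentState d i) (descentState d (ℕ.suc i)) ≈ 0#
  descentStep d ℕ.zero    = proj₁ (proj₂ (lightSuccessor d))
  descentStep d (ℕ.suc i) = descentStep (descend d) i

  descentPath : LightCover → Path
  descentPath d = record { state = descentState d ; step = descentStep d }

  -- Following `w` along the descent strips it letter by letter to `[]`, whose mass 1 as a single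
  -- term already contradicts lightness.
  descentPath-uncovered : ∀ d n w → cover d n ≡ just w → ¬ Follows (descentPath d) w
  descentPath-uncovered d n [] c≡ _ = <⇒≱ (light d (ℕ.suc n))
    (≤-respˡ (reflexive (≡.cong (massOf (origin d)) c≡))
      (term≤∑< (λ i → massOf-nonNeg (origin d) (cover d i)) n))
  descentPath-uncovered d n (t ∷ w) c≡ (≡.refl , follows) =
    descentPath-uncovered (descend d) n w
      (≡.trans (≡.cong (residual t) c≡) (residual-∷ t w))
      follows

  nextWeight : State → (State → Bool) → Carrier
  nextWeight s f = sum λ t → P s t * 𝟙 (f t)

  _∷ₚ_ : ∀ {s} (τ : Path) → ¬ P s (first τ) ≈ 0# → Path
  _∷ₚ_ {s} τ P≉0 = record
    { state = λ { ℕ.zero → s ; (ℕ.suc i) → state τ i }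
    ; step  = λ { ℕ.zero → P≉0 ; (ℕ.suc i) → step τ i } }

  module _ {s : State} {A : Pred (Fin 1 → Path) 0ℓ} {f : State → Bool} where

    -- The residuals at each possible successor `t` with `f t` must have mass at least 1. Otherwise
    -- the descent from `t`, prefixed by `s`, is a path in `A` that the cover misses.
    nextWeight≤cover : (∀ σ → first (σ 0F) ≡ s → T (f (state (σ 0F) 1)) → A σ) →
      ∀ {r C} → IsCover (λ _ → s) A C → (∀ n → (∑< n) (mass (λ _ → s) ∘ C) ≤ r) → nextWeight s f ≤ r
    nextWeight≤cover f⊆A {r} {C} covers bounded with totalMass-average s c (𝟙 ∘ f) heavy
      where
      c : ℕ → Maybe (List State)
      c n = Maybe.map (λ w → w 0F) (C n)
      heavy : ∀ t → ¬ P s t ≈ 0# → ∃ λ N → 𝟙 (f t) ≤ totalMass t (residual t ∘ c) N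
      heavy t P≉0 with f t in ft
      ... | false = 0 , ≤-refl
      ... | true with light? t (residual t ∘ c)
      ...   | inj₂ heavy′ = heavy′
      ...   | inj₁ light′ = ⊥-elim (absurd
        (covers (λ _ → σ) (λ _ → ≡.refl) (f⊆A (λ _ → σ) ≡.refl (≡.subst T (≡.sym ft) tt))))
        where
        d : LightCover
        d = record { origin = t ; cover = residual t ∘ c ; light = light′ }
        σ : Path
        σ = descentPath d ∷ₚ P≉0
        uncovered : ∀ n w → c n ≡ just w → ¬ Follows σ w
        -- The empty word is its own residual, so it is refuted at the descent path itself; it does
        -- not inspect the first step.
        uncovered n []      c≡ _ = descentPath-uncovered d n [] (≡.cong (residual t) c≡) tt
        uncovered n (_ ∷ w) c≡ (≡.refl , follows) =
          descentPath-uncovered d n w (≡.trans (≡.cong (residual t) c≡) (residual-∷ t w)) follows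
        absurd : ¬ (∃ λ n → InRectangle (λ _ → σ) (C n))
        absurd (n , inside) with C n in Cn
        ... | just w = uncovered n (w 0F) (≡.cong (Maybe.map (λ w → w 0F)) Cn) (inside 0F)
    ... | N , ≤N = ≤-trans ≤N (≤-respˡ (sum-cong-≋ {N} λ n → mass≈massOf s (C (toℕ n))) (bounded N))

  -- Covers are infinite sequences, so a finite family is continued with empty sets, which have mass
  -- 0.
  pad : ∀ {k} → (Fin k → Rectangle 1) → ℕ → Rectangle 1
  pad {ℕ.zero}  C n         = nothing
  pad {ℕ.suc k} C ℕ.zero    = C zero
  pad {ℕ.suc k} C (ℕ.suc n) = pad (C ∘ suc) n

  pad-toℕ : ∀ {k} (C : Fin k → Rectangle 1) i → pad C (toℕ i) ≡ C i
  pad-toℕ C zero    = ≡.refl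
  pad-toℕ C (suc i) = pad-toℕ (C ∘ suc) i

  mass₁-nonNeg : ∀ s c → 0# ≤ mass {1} (λ _ → s) c
  mass₁-nonNeg s c = ≤-respʳ (sym (mass≈massOf s c)) (massOf-nonNeg s (Maybe.map (λ w → w 0F) c))

  ∑<-pad : ∀ {k} s (C : Fin k → Rectangle 1) n →
           (∑< n) (mass (λ _ → s) ∘ pad C) ≤ sum (mass (λ _ → s) ∘ C)
  ∑<-pad s C ℕ.zero = sum-nonNeg (mass₁-nonNeg s ∘ C)
  ∑<-pad {ℕ.zero}  s C (ℕ.suc n) = ≤-respˡ (sym (+-identityˡ _)) (∑<-pad s C n)
  ∑<-pad {ℕ.suc k} s C (ℕ.suc n) = +-mono-≤ ≤-refl (∑<-pad s (C ∘ suc) n)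

  -- The one-letter cylinders of the states satisfying `f` form a cover of exactly this mass, and no
  -- cover has less by `nextWeight≤cover`; so the infimum is attained. The equivalence concerns only
  -- paths from `s`, as covers do.
  Pr-nextWeight : ∀ {s} {A : Pred (Fin 1 → Path) 0ℓ} {f} →
    (∀ σ → first (σ 0F) ≡ s → A σ ⇔ T (f (state (σ 0F) 1))) → Pr (λ _ → s) A ≈ nextWeight s f
  Pr-nextWeight {s} {A} {f} A⇔f = inf-unique {Bound} (pad C , covers , bounded)
    λ r (_ , covers , bounded) → nextWeight≤cover (λ σ σ₀ → Equivalence.from (A⇔f σ σ₀)) covers bounded
    where
    Bound : Pred Carrier 0ℓ
    Bound r = ∃ λ C → IsCover (λ _ → s) A C × (∀ n → (∑< n) (mass (λ _ → s) ∘ C) ≤ r)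
    C : State → Rectangle 1
    C t = if f t then just (λ _ → t ∷ []) else nothing
    covers : IsCover (λ _ → s) A (pad C)
    covers σ σ₀ σ∈A = toℕ t , ≡.subst (InRectangle σ) (≡.sym (pad-toℕ C t)) inside
      where
      t : State
      t = state (σ 0F) 1
      inside : InRectangle σ (C t)
      inside with f t | Equivalence.to (A⇔f σ (σ₀ 0F)) σ∈A
      ... | true | _ = λ { 0F → ≡.refl , tt }
    mass-C : ∀ t → mass (λ _ → s) (C t) ≈ P s t * 𝟙 (f t)
    mass-C t with f t
    ... | true  = *-identityʳ (P s t * 1#)
    ... | false = sym (zeroʳ (P s t))
    bounded : ∀ n → (∑< n) (mass (λ _ → s) ∘ pad C) ≤ - - nextWeight s f
    bounded n = ≤-respʳ (trans (sum-cong-≋ mass-C) (sym (-‿involutive _))) (∑<-pad s C n)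

  -- Equivalent events have the same covers. This serves the translation, where the events are
  -- arbitrary and no formula for their probability is available.
  Pr-cong : ∀ {s} {A B : Pred (Fin 1 → Path) 0ℓ} → (∀ σ → A σ ⇔ B σ) → Pr (λ _ → s) A ≈ Pr (λ _ → s) B
  Pr-cong A⇔B = -‿cong (sup-cong λ _ → mk⇔
    (λ (C , covers , bounded) → C , (λ σ σ₀ → covers σ σ₀ ∘ Equivalence.from (A⇔B σ)) , bounded)
    (λ (C , covers , bounded) → C , (λ σ σ₀ → covers σ σ₀ ∘ Equivalence.to   (A⇔B σ)) , bounded))

  nextWeight-total : ∀ s → nextWeight s (λ _ → true) ≈ 1#
  nextWeight-total s = trans (sum-cong-≋ λ t → *-identityʳ (P s t)) (row-sum s)

  nextWeight-empty : ∀ s → nextWeight s (λ _ → false) ≈ 0#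
  nextWeight-empty s = sum-zero λ t → zeroʳ (P s t)

  nextWeight-complement : ∀ s f → nextWeight s f ≈ 1# - nextWeight s (notᵇ ∘ f)
  nextWeight-complement s f = trans (sym (//-rightDividesʳ (nextWeight s (notᵇ ∘ f)) (nextWeight s f)))
    (+-congʳ (begin-equality
      nextWeight s f + nextWeight s (notᵇ ∘ f)
        ≈⟨ ∑-distrib-+ (λ t → P s t * 𝟙 (f t)) _ ⟨
      sum (λ t → P s t * 𝟙 (f t) + P s t * 𝟙 (notᵇ (f t)))
        ≈⟨ sum-cong-≋ (λ t → trans (sym (distribˡ (P s t) _ _)) (*-congˡ (𝟙+𝟙not≈1 (f t)))) ⟩
      nextWeight s (λ _ → true)
        ≈⟨ nextWeight-total s ⟩
      1# ∎))

-- Translation of PCTL* into HyperPCTL*.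

module Embedding (em : ExcludedMiddle 0ℓ) (R : CompleteOrderedField) (AP : Set) where

  open OrderedField R
  open Reals em R using (const; fromℚ)
  open Logics em R AP

  -- Strict bounds are negations of reversed weak ones, which is why two of the implications run
  -- from `y` to `x`. Used both for equal numbers and for probabilities in two different chains.
  ∈ᴵ-transfer : ∀ J {x y} → let open Interval J in
    (fromℚ lower ≤ x → fromℚ lower ≤ y) → (y ≤ fromℚ lower → x ≤ fromℚ lower) →
    (x ≤ fromℚ upper → y ≤ fromℚ upper) → (fromℚ upper ≤ y → fromℚ upper ≤ x) →
    x ∈ᴵ J → y ∈ᴵ J
  ∈ᴵ-transfer J {x} {y} l≤ ≤l ≤u u≤ (l , u) = lowerBound lowerClosed l , upperBound upperClosed u
    where
    open Interval J
    lowerBound : ∀ b → (if b then fromℚ lower ≤ x else fromℚ lower < x) →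
                       (if b then fromℚ lower ≤ y else fromℚ lower < y)
    lowerBound true  l≤x = l≤ l≤x
    lowerBound false l<x = ≰⇒> (<⇒≱ l<x ∘ ≤l)
    upperBound : ∀ b → (if b then x ≤ fromℚ upper else x < fromℚ upper) →
                       (if b then y ≤ fromℚ upper else y < fromℚ upper)
    upperBound true  x≤u = ≤u x≤u
    upperBound false x<u = ≰⇒> (<⇒≱ x<u ∘ u≤)

  ∈ᴵ-resp : ∀ J {x y} → x ≈ y → x ∈ᴵ J → y ∈ᴵ J
  ∈ᴵ-resp J x≈y = ∈ᴵ-transfer J (≤-respʳ x≈y) (≤-respˡ (sym x≈y)) (≤-respˡ x≈y) (≤-respʳ (sym x≈y))

  constant : ∀ {n} → Carrier → ProbExpr n
  constant c = app {k = 0} (const c) λ ()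

  inInterval : ∀ {n} → Interval → ProbExpr n → HyperFormula n
  inInterval J ρ = and (comp (if lowerClosed then le else lt) (constant (fromℚ lower)) ρ)
                       (comp (if upperClosed then le else lt) ρ (constant (fromℚ upper)))
    where open Interval J

  -- The path under consideration is always the most recently bound variable.
  onState : ∀ {n} → StateFormula → HyperFormula (ℕ.suc n)
  onPath  : ∀ {n} → PathFormula → HyperFormula (ℕ.suc n)

  onState (atom a)  = atom a 0F
  onState (not Φ)   = not (onState Φ)
  onState (and Φ Ψ) = and (onState Φ) (onState Ψ)
  onState (ℙ J φ)   = inInterval J (ℙ 0 (onPath φ)) at 0F

  onPath (now Φ)       = onState Φ
  onPath (not φ)       = not (onPath φ)
  onPath (and φ ψ)     = and (onPath φ) (onPath ψ)
  onPath (next φ)      = next (onPath φ)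
  onPath (until k φ ψ) = until k (onPath φ) (onPath ψ)

  -- A closed formula can mention a state only inside a probability: Φ depends on
  -- the first state of the path alone, so its probability is 1 or 0.
  atInit : StateFormula → HyperFormula 0
  atInit Φ = comp eq (ℙ 0 (onState Φ)) (constant 1#)

  compare-if : ∀ b {x y} → compare (if b then le else lt) x y ≡ (if b then x ≤ y else x < y)
  compare-if true  = ≡.refl
  compare-if false = ≡.refl

  module _ (M : DTMC) where

    open Paths M
    open PCTL* M
    open HyperPCTL* M
    open Assignment
    open Measure em R AP M

    inInterval-correct : ∀ {n} J (ρ : ProbExpr n) V → (⟦ ρ ⟧ V ∈ᴵ J) ≡ (V ⊨ inInterval J ρ)
    inInterval-correct J ρ V = ≡.sym (≡.cong₂ _×_ (compare-if lowerClosed) (compare-if upperClosed))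
      where open Interval J

    -- The assignment must be arbitrary for the induction through temporal operators. In the case of
    -- `ℙ`, `at` moves the origin to the current state of the path, so that the new random path
    -- starts there.
    onState-correct : ∀ Φ {n} (V : Assignment (ℕ.suc n)) → (first (path V 0F) ⊨ˢ Φ) ⇔ (V ⊨ onState Φ)
    onPath-correct  : ∀ φ {n} (V : Assignment (ℕ.suc n)) → (path V 0F ⊨ᵖ φ) ⇔ (V ⊨ onPath φ)

    onState-correct (atom a)  V = mk⇔ id id
    onState-correct (not Φ)   V = mk⇔ (_∘ from) (_∘ to)
      where open Equivalence (onState-correct Φ V)
    onState-correct (and Φ Ψ) V = onState-correct Φ V ×-⇔ onState-correct Ψ V
    onState-correct (ℙ J φ)   V = mk⇔
      (≡.subst id (inInterval-correct J ρ W) ∘ ∈ᴵ-resp J Pr≈)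
      (∈ᴵ-resp J (sym Pr≈) ∘ ≡.subst id (≡.sym (inInterval-correct J ρ W)))
      where
      W : Assignment _
      W = assignAll (path V 0F)
      ρ : ProbExpr _
      ρ = ℙ 0 (onPath φ)
      Pr≈ : Pr {1} (λ _ → first (path V 0F)) (λ σ → σ 0F ⊨ᵖ φ) ≈ ⟦ ρ ⟧ W
      Pr≈ = Pr-cong λ σ → onPath-correct φ (extend σ W)

    onPath-correct (now Φ)       V = onState-correct Φ V
    onPath-correct (not φ)       V = mk⇔ (_∘ from) (_∘ to)
      where open Equivalence (onPath-correct φ V)
    onPath-correct (and φ ψ)     V = onPath-correct φ V ×-⇔ onPath-correct ψ V
    onPath-correct (next φ)      V = onPath-correct φ (shift 1 V)
    onPath-correct (until k φ ψ) V = mk⇔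
      (λ (i , i≤k , ψᵢ , φⱼ) → i , i≤k , to (onPath-correct ψ (shift i V)) ψᵢ ,
                               λ j j<i → to (onPath-correct φ (shift j V)) (φⱼ j j<i))
      (λ (i , i≤k , ψᵢ , φⱼ) → i , i≤k , from (onPath-correct ψ (shift i V)) ψᵢ ,
                               λ j j<i → from (onPath-correct φ (shift j V)) (φⱼ j j<i))
      where open Equivalence

    -- The event is decided by the starting state, so it agrees with a constant Boolean function of
    -- the second state.
    Pr-onState : ∀ Φ {b} → (init ⊨ˢ Φ) ⇔ T b → ⟦ ℙ 0 (onState Φ) ⟧ default ≈ nextWeight init (λ _ → b)
    Pr-onState Φ {b} Φ⇔b = Pr-nextWeight λ σ σ₀ →
      ⇔-trans (⇔-sym (onState-correct Φ (extend σ default)))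
              (≡.subst (λ s → (s ⊨ˢ Φ) ⇔ T b) (≡.sym σ₀) Φ⇔b)

    atInit-correct : ∀ Φ → (M ⊨ᴾ Φ) ⇔ (M ⊨ᴴ atInit Φ)
    atInit-correct Φ with em {init ⊨ˢ Φ}
    ... | yes Φ-holds = mk⇔ (λ _ → trans (Pr-onState Φ (mk⇔ (λ _ → tt) λ _ → Φ-holds)) (nextWeight-total init))
                            (λ _ → Φ-holds)
    ... | no Φ-fails  = mk⇔ (⊥-elim ∘ Φ-fails) λ Pr≈1 → ⊥-elim (0≉1 (trans
                          (sym (trans (Pr-onState Φ (mk⇔ Φ-fails ⊥-elim)) (nextWeight-empty init))) Pr≈1))

-- Inexpressibility of the equality of two probabilities in PCTL*.

module Separation (em : ExcludedMiddle 0ℓ) (R : CompleteOrderedField) (AP : Set) where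

  open OrderedField R
  open Reals em R using (fromℚ)
  open Logics em R AP
  open Embedding em R AP using (∈ᴵ-resp; ∈ᴵ-transfer)
  open Measure em R AP using (nextWeight; nextWeight-complement; Pr-nextWeight)

  -- A two-parameter family of Markov chains and their paths.

  record Point : Set where
    field
      x y   : Carrier
      0≤x   : 0# ≤ x
      0≤y   : 0# ≤ y
      x+y≤1 : x + y ≤ 1#

  open Point

  unit : ∀ {n} → Fin n → Fin n → Carrier
  unit i j = 𝟙 (does (i ≟ j))

  unit-vanish : ∀ {n} (i j : Fin n) → j ≢ i → unit i j ≈ 0#
  unit-vanish i j j≢i with i ≟ j
  ... | yes i≡j = contradiction (≡.sym i≡j) j≢i
  ... | no  _   = refl

  unit-diagonal : ∀ {n} (i : Fin n) → unit i i ≈ 1#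
  unit-diagonal i with i ≟ i
  ... | yes _   = refl
  ... | no  i≢i = contradiction ≡.refl i≢i

  prob : Point → Fin 4 → Fin 4 → Carrier
  prob v 0F = unit 0F
  prob v 1F = unit 0F
  prob v 2F = unit 1F
  prob v 3F 0F = 1# - (x v + y v)
  prob v 3F 1F = x v
  prob v 3F 2F = y v
  prob v 3F 3F = 0#

  prob-nonNeg : ∀ v s t → 0# ≤ prob v s t
  prob-nonNeg v 0F t = 0≤𝟙 (does (0F ≟ t))
  prob-nonNeg v 1F t = 0≤𝟙 (does (0F ≟ t))
  prob-nonNeg v 2F t = 0≤𝟙 (does (1F ≟ t))
  prob-nonNeg v 3F 0F = x+y≤z⇒x≤z-y (≤-respˡ (sym (+-identityˡ _)) (x+y≤1 v))
  prob-nonNeg v 3F 1F = 0≤x v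
  prob-nonNeg v 3F 2F = 0≤y v
  prob-nonNeg v 3F 3F = ≤-refl

  unit-sum : ∀ {n} (i : Fin n) → sum (unit i) ≈ 1#
  unit-sum i = trans (sum-supported i (unit-vanish i)) (unit-diagonal i)

  prob-sum : ∀ v s → sum (prob v s) ≈ 1#
  prob-sum v 0F = unit-sum {4} 0F
  prob-sum v 1F = unit-sum {4} 0F
  prob-sum v 2F = unit-sum {4} 1F
  prob-sum v 3F = trans (+-congˡ (+-congˡ (trans (+-congˡ (+-identityʳ 0#)) (+-identityʳ (y v)))))
                        (//-rightDividesˡ (x v + y v) 1#)

  -- State 3 moves to 1, 2, 0 with probabilities x, y, 1 - x - y; the states then
  -- count down to 0.  Only state 1 is labelled, so it is visited after one step
  -- with probability x and after two steps with probability y.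
  model : Point → DTMC
  model v = record
    { size    = 4
    ; init    = 3F
    ; P       = prob v
    ; P≥0     = prob-nonNeg v
    ; P≤1     = λ s t → ≤-respʳ (prob-sum v s) (lookup≤sum (prob-nonNeg v s) t)
    ; row-sum = prob-sum v
    ; label   = λ s _ → does (s ≟ 1F)
    }

  open Paths using (Path; suffix; Pr)
  open Path

  -- State 3 has no incoming transition, so the existence of a predecessor `r` excludes the only
  -- state that branches.
  prob-step : ∀ v r s t → ¬ prob v r s ≈ 0# → ¬ prob v s t ≈ 0# → t ≡ pred s
  prob-step v r 0F t _ ≉0 with t ≟ 0F
  ... | yes t≡0 = t≡0
  ... | no  t≢0 = contradiction (unit-vanish 0F t t≢0) ≉0
  prob-step v r 1F t _ ≉0 with t ≟ 0F
  ... | yes t≡0 = t≡0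
  ... | no  t≢0 = contradiction (unit-vanish 0F t t≢0) ≉0
  prob-step v r 2F t _ ≉0 with t ≟ 1F
  ... | yes t≡1 = t≡1
  ... | no  t≢1 = contradiction (unit-vanish 1F t t≢1) ≉0
  prob-step v 0F 3F t ≉0 _ = contradiction refl ≉0
  prob-step v 1F 3F t ≉0 _ = contradiction refl ≉0
  prob-step v 2F 3F t ≉0 _ = contradiction refl ≉0
  prob-step v 3F 3F t ≉0 _ = contradiction refl ≉0

  path-step : ∀ v (σ : Path (model v)) i → state σ (2 ℕ.+ i) ≡ pred (state σ (1 ℕ.+ i))
  path-step v σ i = prob-step v (state σ i) (state σ (1 ℕ.+ i)) (state σ (2 ℕ.+ i)) (step σ i) (step σ (ℕ.suc i))

  module _ {u v : Point} (σ : Path (model u)) (τ : Path (model v)) where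

    -- The paths may belong to different chains, hence to different types; they are compared through
    -- their state sequences.
    path-determined : state σ 0 ≡ state τ 0 → state σ 1 ≡ state τ 1 → ∀ i → state σ i ≡ state τ i
    path-determined eq₀ eq₁ 0               = eq₀
    path-determined eq₀ eq₁ 1               = eq₁
    path-determined eq₀ eq₁ (ℕ.suc (ℕ.suc i)) = ≡.trans (path-step u σ i)
      (≡.trans (≡.cong pred (path-determined eq₀ eq₁ (ℕ.suc i))) (≡.sym (path-step v τ i)))

  suffix-cong : ∀ {u v} (σ : Path (model u)) (τ : Path (model v)) → (∀ i → state σ i ≡ state τ i) →
                ∀ k i → state (suffix (model u) k σ) i ≡ state (suffix (model v) k τ) i
  suffix-cong σ τ σ≗τ ℕ.zero    i = σ≗τ i
  suffix-cong σ τ σ≗τ (ℕ.suc k) i = suffix-cong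
    (record { state = state σ ∘ ℕ.suc ; step = step σ ∘ ℕ.suc })
    (record { state = state τ ∘ ℕ.suc ; step = step τ ∘ ℕ.suc }) (σ≗τ ∘ ℕ.suc) k i

  -- Nondegenerate parameter intervals and the squares over them.

  record Range : Set where
    field
      lo hi   : Carrier
      lo<hi   : lo < hi
      0≤lo    : 0# ≤ lo
      hi+hi≤1 : hi + hi ≤ 1#

  open Range

  record _⊆_ (J I : Range) : Set where
    field
      lo≤ : lo I ≤ lo J
      ≤hi : hi J ≤ hi I

  open _⊆_

  ⊆-refl : ∀ {I} → I ⊆ I
  ⊆-refl = record { lo≤ = ≤-refl ; ≤hi = ≤-refl }

  ⊆-trans : ∀ {I J K} → I ⊆ J → J ⊆ K → I ⊆ K
  ⊆-trans I⊆J J⊆K = record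
    { lo≤ = ≤-trans (lo≤ J⊆K) (lo≤ I⊆J)
    ; ≤hi = ≤-trans (≤hi I⊆J) (≤hi J⊆K) }

  Within : Range → Carrier → Set
  Within I p = lo I ≤ p × p ≤ hi I

  -- The square over `I`. With one interval for both coordinates, it contains points with `x = y`
  -- and, as `lo < hi`, points with `x` and `y` different; `hi+hi≤1` makes all of it admissible.
  record _∈ᴾ_ (v : Point) (I : Range) : Set where
    constructor within
    field
      x∈ : Within I (x v)
      y∈ : Within I (y v)

  open _∈ᴾ_

  ∈ᴾ-⊆ : ∀ {I J v} → J ⊆ I → v ∈ᴾ J → v ∈ᴾ I
  ∈ᴾ-⊆ {I} {J} J⊆I (within x∈ y∈) = within (widen x∈) (widen y∈)
    where
    widen : ∀ {p} → Within J p → Within I p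
    widen (lo≤p , p≤hi) = ≤-trans (lo≤ J⊆I) lo≤p , ≤-trans p≤hi (≤hi J⊆I)

  point : ∀ I {p q} → Within I p → Within I q → Point
  point I {p} {q} (lo≤p , p≤hi) (lo≤q , q≤hi) = record
    { x = p ; y = q
    ; 0≤x = ≤-trans (0≤lo I) lo≤p ; 0≤y = ≤-trans (0≤lo I) lo≤q
    ; x+y≤1 = ≤-trans (+-mono-≤ p≤hi q≤hi) (hi+hi≤1 I) }

  -- Cut at an interior `m`. If `q < m`, the part from `m` upwards avoids `q`; otherwise the part up
  -- to some `l < m` does.
  avoid : ∀ I q → ∃ λ J → J ⊆ I × ((∀ p → Within J p → q < p) ⊎ (∀ p → Within J p → p < q))
  avoid I q with dense (lo<hi I)
  ... | m , lo<m , m<hi with em {q < m}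
  ...   | yes q<m = J , J⊆I , inj₁ λ p p∈ → ≰⇒> λ p≤q → <⇒≱ q<m (≤-trans (proj₁ p∈) p≤q)
    where
    J : Range
    J = record { lo = m ; hi = hi I ; lo<hi = m<hi
               ; 0≤lo = ≤-trans (0≤lo I) (proj₁ lo<m) ; hi+hi≤1 = hi+hi≤1 I }
    J⊆I : J ⊆ I
    J⊆I = record { lo≤ = proj₁ lo<m ; ≤hi = ≤-refl }
  ...   | no q≮m with dense lo<m
  ...     | l , lo<l , l<m = J , J⊆I , inj₂ λ p p∈ → ≰⇒> λ q≤p → q≮m (≰⇒> λ m≤q →
                               <⇒≱ l<m (≤-trans m≤q (≤-trans q≤p (proj₂ p∈))))
    where
    l≤hi : l ≤ hi I
    l≤hi = ≤-trans (proj₁ l<m) (proj₁ m<hi)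
    J : Range
    J = record { lo = lo I ; hi = l ; lo<hi = lo<l ; 0≤lo = 0≤lo I
               ; hi+hi≤1 = ≤-trans (+-mono-≤ l≤hi l≤hi) (hi+hi≤1 I) }
    J⊆I : J ⊆ I
    J⊆I = record { lo≤ = ≤-refl ; ≤hi = l≤hi }

  -- Keeping a probability on one side of a threshold by shrinking the square.

  Unseparated : Range → (Point → Carrier) → Carrier → Set
  Unseparated I g q = ∀ u v → u ∈ᴾ I → v ∈ᴾ I → (g u ≤ q → g v ≤ q) × (q ≤ g u → q ≤ g v)

  Unseparable : (Point → Carrier) → Set
  Unseparable g = ∀ I q → ∃ λ J → J ⊆ I × Unseparated J g q

  Unseparable-cong : ∀ {g h} → (∀ v → g v ≈ h v) → Unseparable g → Unseparable h
  Unseparable-cong g≈h un I q with un I q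
  ... | J , J⊆I , uns = J , J⊆I , λ u v u∈ v∈ →
    (≤-respˡ (g≈h v) ∘ proj₁ (uns u v u∈ v∈) ∘ ≤-respˡ (sym (g≈h u))) ,
    (≤-respʳ (g≈h v) ∘ proj₂ (uns u v u∈ v∈) ∘ ≤-respʳ (sym (g≈h u)))

  -- Comparing `1 - g` with `q` is comparing `g` with `1 - q` in the reverse order.
  Unseparable-complement : ∀ {g} → Unseparable g → Unseparable (λ v → 1# - g v)
  Unseparable-complement un I q with un I (1# - q)
  ... | J , J⊆I , uns = J , J⊆I , λ u v u∈ v∈ →
    (x-y≤z⇒x-z≤y ∘ proj₂ (uns u v u∈ v∈) ∘ x-y≤z⇒x-z≤y) ,
    (x≤z-y⇒y≤z-x ∘ proj₁ (uns u v u∈ v∈) ∘ x≤z-y⇒y≤z-x)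

  below⊎above : ∀ J g q → (∀ v → v ∈ᴾ J → q < g v) ⊎ (∀ v → v ∈ᴾ J → g v < q) → Unseparated J g q
  below⊎above J g q (inj₁ q<g) u v u∈ v∈ = (λ gu≤q → contradiction gu≤q (<⇒≱ (q<g u u∈))) , (λ _ → proj₁ (q<g v v∈))
  below⊎above J g q (inj₂ g<q) u v u∈ v∈ = (λ _ → proj₁ (g<q v v∈)) , (λ q≤gu → contradiction q≤gu (<⇒≱ (g<q u u∈)))

  x-unseparable : Unseparable x
  x-unseparable I q with avoid I q
  ... | J , J⊆I , inj₁ q<p = J , J⊆I , below⊎above J x q (inj₁ λ v v∈ → q<p (x v) (x∈ v∈))
  ... | J , J⊆I , inj₂ p<q = J , J⊆I , below⊎above J x q (inj₂ λ v v∈ → p<q (x v) (x∈ v∈))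

  y-unseparable : Unseparable y
  y-unseparable I q with avoid I q
  ... | J , J⊆I , inj₁ q<p = J , J⊆I , below⊎above J y q (inj₁ λ v v∈ → q<p (y v) (y∈ v∈))
  ... | J , J⊆I , inj₂ p<q = J , J⊆I , below⊎above J y q (inj₂ λ v v∈ → p<q (y v) (y∈ v∈))

  x+y-unseparable : Unseparable λ v → x v + y v
  x+y-unseparable I q with avoid I (q * ½)
  -- If both coordinates lie on the same side of `q / 2`, their sum lies on that side of `q`.
  ... | J , J⊆I , inj₁ q½<p = J , J⊆I , below⊎above J (λ v → x v + y v) q (inj₁ λ v v∈ → ≰⇒> λ x+y≤q →
          <⇒≱ (+-mono-< (q½<p (x v) (x∈ v∈)) (q½<p (y v) (y∈ v∈))) (≤-respʳ (sym (x½+x½≈x q)) x+y≤q))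
  ... | J , J⊆I , inj₂ p<q½ = J , J⊆I , below⊎above J (λ v → x v + y v) q (inj₂ λ v v∈ → ≰⇒> λ q≤x+y →
          <⇒≱ (+-mono-< (p<q½ (x v) (x∈ v∈)) (p<q½ (y v) (y∈ v∈))) (≤-respˡ (sym (x½+x½≈x q)) q≤x+y))

  p1+q0≈p : ∀ p q → p * 1# + q * 0# ≈ p
  p1+q0≈p p q = trans (+-cong (*-identityʳ p) (zeroʳ q)) (+-identityʳ p)

  p0+q1≈q : ∀ p q → p * 0# + q * 1# ≈ q
  p0+q1≈q p q = trans (+-cong (zeroʳ p) (*-identityʳ q)) (+-identityˡ q)

  p1+q1≈p+q : ∀ p q → p * 1# + q * 1# ≈ p + q
  p1+q1≈p+q p q = +-cong (*-identityʳ p) (*-identityʳ q)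

  x𝟙+y𝟙-unseparable : ∀ b c → Unseparable λ v → x v * 𝟙 b + y v * 𝟙 c
  x𝟙+y𝟙-unseparable true  true  = Unseparable-cong (λ v → sym (p1+q1≈p+q (x v) (y v))) x+y-unseparable
  x𝟙+y𝟙-unseparable true  false = Unseparable-cong (λ v → sym (p1+q0≈p (x v) (y v))) x-unseparable
  x𝟙+y𝟙-unseparable false true  = Unseparable-cong (λ v → sym (p0+q1≈q (x v) (y v))) y-unseparable
  x𝟙+y𝟙-unseparable false false I q = I , ⊆-refl , λ u v _ _ → ≤-respˡ (vanish u v) , ≤-respʳ (vanish u v)
    where
    vanish : ∀ u v → x u * 0# + y u * 0# ≈ x v * 0# + y v * 0#
    vanish u v = +-cong (trans (zeroʳ (x u)) (sym (zeroʳ (x v)))) (trans (zeroʳ (y u)) (sym (zeroʳ (y v))))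

  weight : Fin 4 → (Fin 4 → Bool) → Point → Carrier
  weight s f v = nextWeight (model v) s f

  weight-init : ∀ f → f 0F ≡ false → ∀ v → x v * 𝟙 (f 1F) + y v * 𝟙 (f 2F) ≈ weight 3F f v
  weight-init f f₀ v = sym (begin-equality
    weight 3F f v
      ≈⟨ +-congʳ (trans (reflexive (≡.cong (λ b → prob v 3F 0F * 𝟙 b) f₀)) (zeroʳ _)) ⟩
    0# + (x v * 𝟙 (f 1F) + (y v * 𝟙 (f 2F) + (0# * 𝟙 (f 3F) + 0#)))
      ≈⟨ +-identityˡ _ ⟩
    x v * 𝟙 (f 1F) + (y v * 𝟙 (f 2F) + (0# * 𝟙 (f 3F) + 0#))
      ≈⟨ +-congˡ (+-congˡ (trans (+-identityʳ _) (zeroˡ _))) ⟩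
    x v * 𝟙 (f 1F) + (y v * 𝟙 (f 2F) + 0#)
      ≈⟨ +-congˡ (+-identityʳ _) ⟩
    x v * 𝟙 (f 1F) + y v * 𝟙 (f 2F) ∎)

  -- If state 0 is among the selected ones, passing to the complement removes the term
  -- `1 - (x + y)`, leaving a sum of some of `x` and `y`.
  weight-unseparable : ∀ f → Unseparable (weight 3F f)
  weight-unseparable f = split (f 0F) ≡.refl
    where
    split : ∀ b → f 0F ≡ b → Unseparable (weight 3F f)
    split false f₀ = Unseparable-cong (weight-init f f₀) (x𝟙+y𝟙-unseparable (f 1F) (f 2F))
    split true  f₀ = Unseparable-cong (λ v → sym (nextWeight-complement (model v) 3F f))
      (Unseparable-complement (Unseparable-cong (weight-init (notᵇ ∘ f) (≡.cong notᵇ f₀))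
        (x𝟙+y𝟙-unseparable (notᵇ (f 1F)) (notᵇ (f 2F)))))

  unseparated : ∀ I q (f : Fin 4 → Fin 4 → Bool) → ∃ λ J → J ⊆ I × (∀ s → Unseparated J (weight s (f s)) q)
  unseparated I q f with weight-unseparable (f 3F) I q
  ... | J , J⊆I , uns = J , J⊆I , λ
    -- The transition probabilities out of states 0, 1 and 2 are the same in all chains; only state
    -- 3 requires shrinking.
    { 0F u v _ _ → id , id ; 1F u v _ _ → id , id ; 2F u v _ _ → id , id ; 3F → uns }

  -- Every PCTL* formula is constant on some smaller square.

  Constantˢ : Range → Fin 4 → StateFormula → Set
  Constantˢ I s Φ = ∀ u v → u ∈ᴾ I → v ∈ᴾ I → PCTL*._⊨ˢ_ (model u) s Φ → PCTL*._⊨ˢ_ (model v) s Φ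

  Constantᵖ : Range → PathFormula → Set
  Constantᵖ I φ = ∀ u v → u ∈ᴾ I → v ∈ᴾ I → (σ : Path (model u)) (τ : Path (model v)) →
    (∀ i → state σ i ≡ state τ i) → PCTL*._⊨ᵖ_ (model u) σ φ → PCTL*._⊨ᵖ_ (model v) τ φ

  -- The witness may come from any chain of the square, which makes the set of second states
  -- independent of the parameters.
  HasPath : Range → PathFormula → Fin 4 → Fin 4 → Set
  HasPath I φ s t = ∃ λ v → v ∈ᴾ I × (∃ λ (σ : Path (model v)) →
    state σ 0 ≡ s × state σ 1 ≡ t × PCTL*._⊨ᵖ_ (model v) σ φ)

  secondStates : Range → PathFormula → Fin 4 → Fin 4 → Bool
  secondStates I φ s t = ⌊ em {HasPath I φ s t} ⌋

  -- A witness from another chain has the same states as the given path, because the first two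
  -- determine the rest; constancy of `φ` then transfers its truth.
  Pr-secondStates : ∀ I φ → Constantᵖ I φ → ∀ s v → v ∈ᴾ I →
    Pr (model v) {1} (λ _ → s) (λ σ → PCTL*._⊨ᵖ_ (model v) (σ 0F) φ) ≈ weight s (secondStates I φ s) v
  Pr-secondStates I φ const s v v∈ = Pr-nextWeight (model v) {f = secondStates I φ s} λ σ σ₀ → mk⇔
    (λ σ⊨φ → fromWitness {a? = em {HasPath I φ s _}} (v , v∈ , σ 0F , σ₀ , ≡.refl , σ⊨φ))
    (λ found → let u , u∈ , τ , τ₀ , τ₁ , τ⊨φ = toWitness {a? = em {HasPath I φ s _}} found in
      const u v u∈ v∈ τ (σ 0F) (path-determined τ (σ 0F) (≡.trans τ₀ (≡.sym σ₀)) τ₁) τ⊨φ)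

  mutual

    constantˢ : ∀ Φ I → ∃ λ J → J ⊆ I × (∀ s → Constantˢ J s Φ)
    constantˢ (atom a)  I = I , ⊆-refl , λ s u v _ _ → id
    constantˢ (not Φ)   I with constantˢ Φ I
    ... | J , J⊆I , Φ-const = J , J⊆I , λ s u v u∈ v∈ → _∘ Φ-const s v u v∈ u∈
    constantˢ (and Φ Ψ) I with constantˢ Φ I
    ... | J , J⊆I , Φ-const with constantˢ Ψ J
    ...   | K , K⊆J , Ψ-const = K , ⊆-trans K⊆J J⊆I , λ s u v u∈ v∈ (Φ-holds , Ψ-holds) →
      Φ-const s u v (∈ᴾ-⊆ K⊆J u∈) (∈ᴾ-⊆ K⊆J v∈) Φ-holds , Ψ-const s u v u∈ v∈ Ψ-holds
    constantˢ (ℙ J φ)   I with constantᵖ φ I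
    -- Once `φ` is constant on `I′`, its set of second states is fixed there and kept; two further
    -- shrinkings deal with the two end points of `J`.
    ... | I′ , I′⊆I , φ-const with unseparated I′ (fromℚ (Interval.lower J)) (secondStates I′ φ)
    ...   | K , K⊆I′ , lower-uns with unseparated K (fromℚ (Interval.upper J)) (secondStates I′ φ)
    ...     | L , L⊆K , upper-uns = L , ⊆-trans L⊆K (⊆-trans K⊆I′ I′⊆I) , λ s u v u∈L v∈L →
      let u∈K = ∈ᴾ-⊆ L⊆K u∈L
          v∈K = ∈ᴾ-⊆ L⊆K v∈L
      in
        ∈ᴵ-resp J (sym (Pr-secondStates I′ φ φ-const s v (∈ᴾ-⊆ K⊆I′ v∈K)))
      ∘ ∈ᴵ-transfer J (proj₂ (lower-uns s u v u∈K v∈K)) (proj₁ (lower-uns s v u v∈K u∈K))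
                      (proj₁ (upper-uns s u v u∈L v∈L)) (proj₂ (upper-uns s v u v∈L u∈L))
      ∘ ∈ᴵ-resp J (Pr-secondStates I′ φ φ-const s u (∈ᴾ-⊆ K⊆I′ u∈K))

    constantᵖ : ∀ φ I → ∃ λ J → J ⊆ I × Constantᵖ J φ
    constantᵖ (now Φ)       I with constantˢ Φ I
    ... | J , J⊆I , Φ-const = J , J⊆I , λ u v u∈ v∈ σ τ σ≗τ σ⊨ →
      Φ-const (state τ 0) u v u∈ v∈ (≡.subst (λ s → PCTL*._⊨ˢ_ (model u) s Φ) (σ≗τ 0) σ⊨)
    constantᵖ (not φ)       I with constantᵖ φ I
    ... | J , J⊆I , φ-const = J , J⊆I , λ u v u∈ v∈ σ τ σ≗τ → _∘ φ-const v u v∈ u∈ τ σ (≡.sym ∘ σ≗τ)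
    constantᵖ (and φ ψ)     I with constantᵖ φ I
    ... | J , J⊆I , φ-const with constantᵖ ψ J
    ...   | K , K⊆J , ψ-const = K , ⊆-trans K⊆J J⊆I , λ u v u∈ v∈ σ τ σ≗τ (φ-holds , ψ-holds) →
      φ-const u v (∈ᴾ-⊆ K⊆J u∈) (∈ᴾ-⊆ K⊆J v∈) σ τ σ≗τ φ-holds , ψ-const u v u∈ v∈ σ τ σ≗τ ψ-holds
    constantᵖ (next φ)      I with constantᵖ φ I
    ... | J , J⊆I , φ-const = J , J⊆I , λ u v u∈ v∈ σ τ σ≗τ →
      φ-const u v u∈ v∈ (suffix (model u) 1 σ) (suffix (model v) 1 τ) (suffix-cong σ τ σ≗τ 1)
    constantᵖ (until k φ ψ) I with constantᵖ φ I
    ... | J , J⊆I , φ-const with constantᵖ ψ J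
    ...   | K , K⊆J , ψ-const = K , ⊆-trans K⊆J J⊆I , λ u v u∈ v∈ σ τ σ≗τ (i , i≤k , ψᵢ , φⱼ) →
      i , i≤k ,
      ψ-const u v u∈ v∈ (suffix (model u) i σ) (suffix (model v) i τ) (suffix-cong σ τ σ≗τ i) ψᵢ ,
      λ j j<i → φ-const u v (∈ᴾ-⊆ K⊆J u∈) (∈ᴾ-⊆ K⊆J v∈)
        (suffix (model u) j σ) (suffix (model v) j τ) (suffix-cong σ τ σ≗τ j) (φⱼ j j<i)

  -- The separating formula and the contradiction.

  sameProbability : AP → HyperFormula 0
  sameProbability a = comp eq (ℙ 0 (next (atom a 0F))) (ℙ 0 (next (next (atom a 0F))))

  sameProbability-correct : ∀ a v → (model v ⊨ᴴ sameProbability a) ⇔ (x v ≈ y v)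
  sameProbability-correct a v = mk⇔
    (λ same → trans (sym first≈) (trans same second≈))
    (λ x≈y → trans first≈ (trans x≈y (sym second≈)))
    where
    open HyperPCTL* (model v)
    isOne : Fin 4 → Bool
    isOne t = does (t ≟ 1F)
    first≈ : ⟦ ℙ 0 (next (atom a 0F)) ⟧ default ≈ x v
    first≈ = trans (Pr-nextWeight (model v) {f = isOne} λ σ _ → mk⇔ id id)
      (trans (sym (weight-init isOne ≡.refl v)) (p1+q0≈p (x v) (y v)))
    second≈ : ⟦ ℙ 0 (next (next (atom a 0F))) ⟧ default ≈ y v
    -- Whether the third state is 1 can be read off the second state, since from there on the chain
    -- counts down.
    second≈ = trans (Pr-nextWeight (model v) {f = isOne ∘ pred} λ σ _ → atSecond (σ 0F))
      (trans (sym (weight-init (isOne ∘ pred) ≡.refl v)) (p0+q1≈q (x v) (y v)))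
      where
      atSecond : ∀ σ → T (isOne (state σ 2)) ⇔ T (isOne (pred (state σ 1)))
      atSecond σ rewrite path-step v σ 0 = mk⇔ id id

  unitRange : Range
  unitRange = record
    { lo = 0# ; hi = ½ ; lo<hi = 0≤½ , 0≉½ ; 0≤lo = ≤-refl ; hi+hi≤1 = ≤-reflexive ½+½≈1 }
    where
    0≉½ : ¬ 0# ≈ ½
    0≉½ 0≈½ = 0≉1 (trans (sym (+-identityˡ 0#)) (trans (+-cong 0≈½ 0≈½) ½+½≈1))

  sameProbability-inexpressible : ∀ a → ¬ ∃ λ Φ → ∀ M → (M ⊨ᴴ sameProbability a) ⇔ (M ⊨ᴾ Φ)
  sameProbability-inexpressible a (Φ , equivalent) with constantˢ Φ unitRange
  -- On the square where `Φ` is constant, `u` lies on the diagonal and satisfies the formula, while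
  -- `v` has the distinct coordinates `lo J` and `hi J`.
  ... | J , _ , Φ-const = proj₂ (lo<hi J) (Equivalence.to (sameProbability-correct a v)
    (Equivalence.from (equivalent (model v)) (Φ-const 3F u v (within lo∈ lo∈) (within lo∈ hi∈)
      (Equivalence.to (equivalent (model u)) (Equivalence.from (sameProbability-correct a u) refl)))))
    where
    lo∈ : Within J (lo J)
    lo∈ = ≤-refl , proj₁ (lo<hi J)
    hi∈ : Within J (hi J)
    hi∈ = proj₁ (lo<hi J) , ≤-refl
    u v : Point
    u = point J lo∈ lo∈
    v = point J lo∈ hi∈

theorem2 : (em : ExcludedMiddle 0ℓ) (R : CompleteOrderedField) (AP : Set) → AP →
    let open Logics em R AP in
    (∀ (Φ : StateFormula) → ∃ λ (φ : HyperFormula 0) → ∀ (M : DTMC) → (M ⊨ᴾ Φ) ⇔ (M ⊨ᴴ φ))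
    × (∃ λ (φ : HyperFormula 0) → ¬ (∃ λ (Φ : StateFormula) → ∀ (M : DTMC) → (M ⊨ᴴ φ) ⇔ (M ⊨ᴾ Φ)))
theorem2 em R AP a =
  (λ Φ → Embedding.atInit em R AP Φ , λ M → Embedding.atInit-correct em R AP M Φ) ,
  (Separation.sameProbability em R AP a , Separation.sameProbability-inexpressible em R AP a)
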